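{- Let $\alpha,\theta$ be ordinals with $1 \leq \alpha\leq \theta < \omega_1$. If $\theta<R(\alpha,3)$, then $\omega^{\theta}\nrightarrow_{cl} (\omega^{\alpha},3)^2$.
   Context: Ordinals carry their order topology. For a set $X$, $[X]^2$ denotes the set of two-element subsets of $X$. For ordinals $\alpha,\beta$ and $X \subseteq \alpha$ (subspace topology), $X$ is a closed copy of $\beta$ if there is a map $X \to \beta$ that is both an order-isomorphism and a homeomorphism. For ordinals $\alpha,\beta,\gamma$, $\gamma \rightarrow_{cl} (\alpha,\beta)^2$ means: for every $\mathfrak{c}:[\gamma]^2 \to \{0,1\}$ there is $X \subseteq \gamma$ which is either a closed copy of $\alpha$ with $\mathfrak{c}\equiv 0$ on $[X]^2$, or a closed copy of $\beta$ with $\mathfrak{c}\equiv 1$ on $[X]^2$; $\gamma \nrightarrow_{cl} (\alpha,\beta)^2$ is its negation. The classical partition relation $\gamma \rightarrow (\alpha,\beta)^2$ is defined in the same way except that $X$ is only required to be order-isomorphic to $\alpha$ (respectively $\beta$). $R(\alpha,3)$ denotes the classical ordinal Ramsey number, i.e. the least ordinal $\gamma$ with $\gamma \rightarrow (\alpha,3)^2$, where $3=\{0,1,2\}$. -}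

module Defs where

open import Level using (0ℓ)
open import Data.Nat using (ℕ) renaming (_<_ to _<ℕ_)
open import Data.Fin using (Fin) renaming (_<_ to _<F_)
import Data.Fin.Properties as FinP
import Data.Fin.Induction as FinI
open import Data.Product using (Σ; ∃; _×_; _,_; proj₁; proj₂)
open import Data.Sum using (_⊎_)
open import Data.Unit using (⊤)
open import Data.Empty using (⊥)
open import Data.Maybe using (Maybe; just; nothing)
open import Data.List using (List; []; _∷_)
open import Relation.Binary.PropositionalEquality using (_≡_)
open import Relation.Binary using (Rel; IsStrictTotalOrder)
open import Induction.WellFounded using (WellFounded)
open import Function using (Injective)

record LO : Set₁ where
  field
    Car : Set
    _≺_ : Rel Car 0ℓ

record Ordinal : Set₁ where
  field
    lo    : LO
  open LO lo public
  field
    isSTO : IsStrictTotalOrder _≡_ _≺_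
    wf    : WellFounded _≺_

open Ordinal using (lo)

fin : ℕ → Ordinal
fin n = record
  { lo    = record { Car = Fin n ; _≺_ = _<F_ }
  ; isSTO = FinP.<-isStrictTotalOrder
  ; wf    = FinI.<-wellFounded }

OrdLe : Ordinal → Ordinal → Set
OrdLe α β = Σ (A.Car → B.Car) λ f →
    (∀ x y → x A.≺ y → f x B.≺ f y)
  × (∀ x b → b B.≺ f x → ∃ λ y → f y ≡ b)
  where module A = Ordinal α ; module B = Ordinal β

OrdLt : Ordinal → Ordinal → Set
OrdLt α β = Σ B.Car λ b → Σ (A.Car → B.Car) λ f →
    (∀ x y → x A.≺ y → f x B.≺ f y)
  × (∀ x → f x B.≺ b)
  × (∀ y → y B.≺ b → ∃ λ x → f x ≡ y)
  where module A = Ordinal α ; module B = Ordinal β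

-- θ < ω₁ : θ is countable
Countable : Ordinal → Set
Countable θ = Σ (Ordinal.Car θ → ℕ) Injective′
  where Injective′ = λ f → ∀ x y → f x ≡ f y → x ≡ y

-- Ordinal exponentiation ω^θ, realised as Cantor normal forms:
-- lists ((t₁,k₁) ∷ … ∷ (tₙ,kₙ)) with t₁ > … > tₙ in θ, standing for
-- ω^t₁·(k₁+1) + … + ω^tₙ·(kₙ+1); ordered lexicographically.

module _ (θ : Ordinal) where
  open Ordinal θ

  Desc : List (Car × ℕ) → Set
  Desc []                = ⊤
  Desc (_ ∷ [])          = ⊤
  Desc (x ∷ y ∷ r)       = (proj₁ y ≺ proj₁ x) × Desc (y ∷ r)

  _<CNF_ : List (Car × ℕ) → List (Car × ℕ) → Set
  []            <CNF []            = ⊥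
  []            <CNF (_ ∷ _)       = ⊤
  (_ ∷ _)       <CNF []            = ⊥
  ((a , m) ∷ r) <CNF ((b , n) ∷ s) =
    (a ≺ b) ⊎ ((a ≡ b) × ((m <ℕ n) ⊎ ((m ≡ n) × (r <CNF s))))

ωpow : Ordinal → LO
ωpow θ = record
  { Car = Σ (List (Ordinal.Car θ × ℕ)) (Desc θ)
  ; _≺_ = λ p q → _<CNF_ θ (proj₁ p) (proj₁ q) }

module _ (A : LO) where
  open LO A

  Above : Maybe Car → Car → Set
  Above nothing  _ = ⊤
  Above (just a) x = a ≺ x

  Below : Maybe Car → Car → Set
  Below nothing  _ = ⊤
  Below (just b) x = x ≺ b

  IsOpen : (Car → Set) → Set
  IsOpen U = ∀ x → U x → Σ (Maybe Car) λ l → Σ (Maybe Car) λ r →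
    Above l x × Below r x × (∀ y → Above l y → Below r y → U y)

  SubOpen : (X : Car → Set) → (Σ Car X → Set) → Set₁
  SubOpen X V = Σ (Car → Set) λ U → IsOpen U ×
    (∀ p → (V p → U (proj₁ p)) × (U (proj₁ p) → V p))

module _ (A : LO) (X : LO.Car A → Set) (B : LO) where
  private
    module A = LO A
    module B = LO B

  IsOrderIso : (Σ A.Car X → B.Car) → Set
  IsOrderIso h =
      (∀ p q → h p ≡ h q → p ≡ q)
    × (∀ b → ∃ λ p → h p ≡ b)
    × (∀ p q → (proj₁ p A.≺ proj₁ q → h p B.≺ h q)
             × (h p B.≺ h q → proj₁ p A.≺ proj₁ q))

  Copy : Set
  Copy = Σ (Σ A.Car X → B.Car) IsOrderIso

  -- X is a closed copy of B: some map X → B is both an order-isomorphism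
  -- and a homeomorphism (X with the subspace topology, B with its order
  -- topology).  Continuity of h⁻¹ is phrased as: h maps subspace-open
  -- sets to open sets.
  ClosedCopy : Set₁
  ClosedCopy = Σ (Σ A.Car X → B.Car) λ h → IsOrderIso h
    × (∀ U → IsOpen B U → SubOpen A X (λ p → U (h p)))
    × (∀ V → SubOpen A X V → IsOpen B (λ b → ∃ λ p → h p ≡ b × V p))

-- colourings of [Car]² : c x y is the colour of {x,y} when x ≺ y
Colouring : LO → Set
Colouring A = LO.Car A → LO.Car A → Fin 2

Homog : (A : LO) → Colouring A → (LO.Car A → Set) → Fin 2 → Set
Homog A c X i = ∀ x y → X x → X y → LO._≺_ A x y → c x y ≡ i

Arrow : LO → LO → LO → Set₁
Arrow γ α β = ∀ (c : Colouring γ) → Σ (LO.Car γ → Set) λ X →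
    (Copy γ X α × Homog γ c X Fin.zero)
  ⊎ (Copy γ X β × Homog γ c X (Fin.suc Fin.zero))
  where import Data.Fin as Fin

ArrowCl : LO → LO → LO → Set₁
ArrowCl γ α β = ∀ (c : Colouring γ) → Σ (LO.Car γ → Set) λ X →
    (ClosedCopy γ X α × Homog γ c X Fin.zero)
  ⊎ (ClosedCopy γ X β × Homog γ c X (Fin.suc Fin.zero))
  where import Data.Fin as Fin

{-# OPTIONS --safe #-}

-- Write rank x for the last exponent of the Cantor normal form of x, that is,
-- the Cantor–Bendixson rank of x in ω^θ.
--
-- A colouring d of [θ]² induces a colouring of [ω^θ]²: the pair {x , y} gets
-- the colour of {rank x , rank y}, and colour 0 if the ranks agree.  A triangle
-- of colour 1 yields one for d.  If g enumerates a closed copy of ω^α of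
-- colour 0, let f β be the least rank of a point g b with rank b = β.  A point
-- of rank γ is a limit of points of every rank β < γ, and points of ω^θ close
-- below x have rank less than rank x, so f is strictly increasing and its range
-- is a copy of α of colour 0 for d.  Thus ω^θ →cl (ω^α , 3)² implies
-- θ → (α , 3)², whence θ < θ.
--
-- The minima defining f exist constructively because the hypothesis on θ
-- provides them.  The relation ω^θ →cl (ω^α , 3)² implies W + ω^θ → (α , 3)²
-- for every ordinal W, so θ is a proper initial segment of W + ω^θ.  The least
-- element of θ goes to the least element of W + ω^θ, which lies in W as soon
-- as W is inhabited; take for W an arbitrary subset of θ.
module Submission where

open import Defs
open import Level using (0ℓ)
open import Data.Empty using (⊥; ⊥-elim)
open import Data.Fin using (Fin; zero; suc; _≟_)
open import Data.List using (List; []; _∷_)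
open import Data.Maybe using (Maybe; just; nothing)
open import Data.Maybe.Properties using (just-injective)
open import Data.Nat using (ℕ; zero; suc; s≤s; z≤n) renaming (_<_ to _<ℕ_)
import Data.Nat.Properties as ℕ
import Data.Nat.Induction as ℕ
open import Data.Product using (Σ; ∃; _×_; _,_; proj₁; proj₂)
open import Data.Sum using (_⊎_; inj₁; inj₂)
open import Data.Unit using (⊤; tt)
open import Induction.WellFounded using (WellFounded; Acc; acc)
open import Relation.Binary using (Rel; IsStrictTotalOrder; Tri; tri<; tri≈; tri>; Transitive; Irreflexive)
import Relation.Binary.Construct.On as On
open import Relation.Binary.PropositionalEquality using (_≡_; refl; sym; trans; cong; cong₂; subst; isEquivalence)
open import Relation.Binary.Structures.Biased using (isStrictTotalOrderᶜ)
open import Relation.Nullary using (¬_; Dec; yes; recompute)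
open import Relation.Nullary.Decidable using (_×-dec_)

open Ordinal using (lo)

-- Strict total orders, subsets and sums of ordinals.

strictTotalOrder : {A : Set} {_<_ : Rel A 0ℓ} → Irreflexive _≡_ _<_ → Transitive _<_ →
                   (∀ x y → x < y ⊎ x ≡ y ⊎ y < x) → IsStrictTotalOrder _≡_ _<_
strictTotalOrder {A} {_<_} irrefl <-trans total = isStrictTotalOrderᶜ record
  { isEquivalence = isEquivalence
  ; trans         = <-trans
  ; compare       = λ x y → tri x y (total x y)
  }
  where
  tri : ∀ x y → x < y ⊎ x ≡ y ⊎ y < x → Tri (x < y) (x ≡ y) (y < x)
  tri x y (inj₁ x<y)        = tri< x<y (λ x≡y → irrefl x≡y x<y) (λ y<x → irrefl refl (<-trans x<y y<x))
  tri x y (inj₂ (inj₁ x≡y)) = tri≈ (irrefl x≡y) x≡y (irrefl (sym x≡y))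
  tri x y (inj₂ (inj₂ y<x)) = tri> (λ x<y → irrefl refl (<-trans x<y y<x)) (λ x≡y → irrefl (sym x≡y) y<x) y<x

module Order (A : Ordinal) where
  open Ordinal A
  open IsStrictTotalOrder isSTO public
    using (compare; irrefl; _<?_) renaming (trans to ≺-trans)

  total : ∀ x y → x ≺ y ⊎ x ≡ y ⊎ y ≺ x
  total x y with compare x y
  ... | tri< x≺y _ _ = inj₁ x≺y
  ... | tri≈ _ x≡y _ = inj₂ (inj₁ x≡y)
  ... | tri> _ _ y≺x = inj₂ (inj₂ y≺x)

-- Membership is an irrelevant field, so that elements are equal as soon as
-- their values are, even though Q is an arbitrary family of sets.
record Sub {A : Set} (Q : A → Set) : Set where
  constructor _∣_
  field
    val    : A
    .holds : Q val

open Sub using (val)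

val-injective : {A : Set} {Q : A → Set} {x y : Sub Q} → val x ≡ val y → x ≡ y
val-injective refl = refl

sub-isStrictTotalOrder : {A : Set} {_<_ : Rel A 0ℓ} (Q : A → Set) → IsStrictTotalOrder _≡_ _<_ →
                         IsStrictTotalOrder {A = Sub Q} _≡_ (λ x y → val x < val y)
sub-isStrictTotalOrder {_<_ = _<_} Q sto = strictTotalOrder
  (λ { refl → O.irrefl refl }) O.trans total
  where
  module O = IsStrictTotalOrder sto
  total : ∀ x y → val x < val y ⊎ x ≡ y ⊎ val y < val x
  total x y with O.compare (val x) (val y)
  ... | tri< x<y _ _ = inj₁ x<y
  ... | tri≈ _ x≡y _ = inj₂ (inj₁ (val-injective x≡y))
  ... | tri> _ _ y<x = inj₂ (inj₂ y<x)

sub : (A : Ordinal) → (Ordinal.Car A → Set) → Ordinal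
sub A Q = record
  { lo    = record { Car = Sub Q ; _≺_ = λ x y → val x A.≺ val y }
  ; isSTO = sub-isStrictTotalOrder Q A.isSTO
  ; wf    = On.wellFounded val A.wf
  }
  where module A = Ordinal A

module _ (A B : Ordinal) where
  private
    module A where
      open Ordinal A public
      open Order A public
    module B where
      open Ordinal B public
      open Order B public

  _⊕<_ : Rel (A.Car ⊎ B.Car) 0ℓ
  inj₁ x ⊕< inj₁ y = x A.≺ y
  inj₁ x ⊕< inj₂ y = ⊤
  inj₂ x ⊕< inj₁ y = ⊥
  inj₂ x ⊕< inj₂ y = x B.≺ y

  private
    ⊕-irrefl : Irreflexive _≡_ _⊕<_
    ⊕-irrefl {inj₁ x} refl = A.irrefl refl
    ⊕-irrefl {inj₂ x} refl = B.irrefl refl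

    ⊕-trans : Transitive _⊕<_
    ⊕-trans {inj₁ x} {inj₁ y} {inj₁ z} p q = A.≺-trans p q
    ⊕-trans {inj₁ x} {inj₁ y} {inj₂ z} p q = tt
    ⊕-trans {inj₁ x} {inj₂ y} {inj₂ z} p q = tt
    ⊕-trans {inj₂ x} {inj₂ y} {inj₂ z} p q = B.≺-trans p q

    ⊕-total : ∀ x y → x ⊕< y ⊎ x ≡ y ⊎ y ⊕< x
    ⊕-total (inj₁ x) (inj₁ y) with A.total x y
    ... | inj₁ p           = inj₁ p
    ... | inj₂ (inj₁ refl) = inj₂ (inj₁ refl)
    ... | inj₂ (inj₂ p)    = inj₂ (inj₂ p)
    ⊕-total (inj₁ x) (inj₂ y) = inj₁ tt
    ⊕-total (inj₂ x) (inj₁ y) = inj₂ (inj₂ tt)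
    ⊕-total (inj₂ x) (inj₂ y) with B.total x y
    ... | inj₁ p           = inj₁ p
    ... | inj₂ (inj₁ refl) = inj₂ (inj₁ refl)
    ... | inj₂ (inj₂ p)    = inj₂ (inj₂ p)

    acc₁ : ∀ {x} → Acc A._≺_ x → Acc _⊕<_ (inj₁ x)
    acc₁ (acc rs) = acc λ { {inj₁ y} p → acc₁ (rs p) }

    acc₂ : ∀ {x} → Acc B._≺_ x → Acc _⊕<_ (inj₂ x)
    acc₂ (acc rs) = acc λ { {inj₁ y} _ → acc₁ (A.wf y) ; {inj₂ y} p → acc₂ (rs p) }

    ⊕-wf : WellFounded _⊕<_
    ⊕-wf (inj₁ x) = acc₁ (A.wf x)
    ⊕-wf (inj₂ x) = acc₂ (B.wf x)

  _⊕_ : Ordinal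
  _⊕_ = record
    { lo    = record { Car = A.Car ⊎ B.Car ; _≺_ = _⊕<_ }
    ; isSTO = strictTotalOrder ⊕-irrefl (λ {x} {y} {z} → ⊕-trans {x} {y} {z}) ⊕-total
    ; wf    = ⊕-wf
    }

-- Least elements and initial segments.

IsLeast : (A : Ordinal) → Ordinal.Car A → Set
IsLeast A a = ∀ x → ¬ Ordinal._≺_ A x a

OrdLe-least : ∀ A B (A≤B : OrdLe A B) {a} → IsLeast A a → IsLeast B (proj₁ A≤B a)
OrdLe-least A B (f , mono , initial) {a} least b b≺fa with initial a b b≺fa
... | y , refl with Order.total A y a
...   | inj₁ y≺a           = least y y≺a
...   | inj₂ (inj₁ refl)   = Order.irrefl B refl b≺fa
...   | inj₂ (inj₂ a≺y)    = Order.irrefl B refl (Order.≺-trans B b≺fa (mono a y a≺y))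

OrdLt⇒OrdLe : ∀ A B → OrdLt A B → OrdLe A B
OrdLt⇒OrdLe A B (b , f , mono , bounded , initial) =
  f , mono , λ x y y≺fx → initial y (Order.≺-trans B y≺fx (bounded x))

-- A strictly increasing self-map of a well-order moves no point down, since `x`, `f x`, `f (f x)`,
-- ... would descend forever. A bound `b` of the range would be moved down.
OrdLt-irrefl : ∀ A → ¬ OrdLt A A
OrdLt-irrefl A (b , f , mono , bounded , _) = nondecreasing b (wf b) (bounded b)
  where
  open Ordinal A
  nondecreasing : ∀ x → Acc _≺_ x → ¬ f x ≺ x
  nondecreasing x (acc rs) fx≺x = nondecreasing (f x) (rs fx≺x) (mono (f x) x fx≺x)

-- Partition relations in terms of embeddings.

Embeds : (A : LO) → Colouring A → LO → Fin 2 → Set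
Embeds A c B i = Σ (LO.Car B → LO.Car A) λ f →
  ∀ x y → LO._≺_ B x y → LO._≺_ A (f x) (f y) × c (f x) (f y) ≡ i

-- Membership in the range of `f` carries the preimage, so the isomorphism is a projection. Totality
-- of both orders lets `f` reflect the order as well as preserve it.
embeds⇒copy : ∀ (A B : Ordinal) c i → Embeds (lo A) c (lo B) i →
              Σ (Ordinal.Car A → Set) λ X → Copy (lo A) X (lo B) × Homog (lo A) c X i
embeds⇒copy A B c i (f , emb) =
  (λ a → ∃ λ b → f b ≡ a)
  , ((λ p → proj₁ (proj₂ p)) , injective , (λ b → (f b , b , refl) , refl) ,
      λ { (_ , x , refl) (_ , y , refl) → reflect x y , λ x≺y → proj₁ (emb x y x≺y) })
  , λ { _ _ (x , refl) (y , refl) fx≺fy → proj₂ (emb x y (reflect x y fx≺fy)) }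
  where
  module A = Ordinal A
  module B = Ordinal B

  injective : ∀ (p q : Σ A.Car λ a → ∃ λ b → f b ≡ a) → proj₁ (proj₂ p) ≡ proj₁ (proj₂ q) → p ≡ q
  injective (_ , x , refl) (_ , .x , refl) refl = refl

  reflect : ∀ x y → f x A.≺ f y → x B.≺ y
  reflect x y fx≺fy with Order.total B x y
  ... | inj₁ x≺y         = x≺y
  ... | inj₂ (inj₁ refl) = ⊥-elim (Order.irrefl A refl fx≺fy)
  ... | inj₂ (inj₂ y≺x)  = ⊥-elim (Order.irrefl A refl (Order.≺-trans A fx≺fy (proj₁ (emb y x y≺x))))

arrow : ∀ (A B C : Ordinal) →
        (∀ c → Embeds (lo A) c (lo B) zero ⊎ Embeds (lo A) c (lo C) (suc zero)) →
        Arrow (lo A) (lo B) (lo C)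
arrow A B C embed c with embed c
... | inj₁ e = let X , copy = embeds⇒copy A B c zero e in X , inj₁ copy
... | inj₂ e = let X , copy = embeds⇒copy A C c (suc zero) e in X , inj₂ copy

module Enumeration (A : LO) (X : LO.Car A → Set) (B : LO)
                   (h : Σ (LO.Car A) X → LO.Car B) (iso : IsOrderIso A X B h) where
  private
    module A = LO A
    module B = LO B

  point : ∀ b → ∃ λ p → h p ≡ b
  point = proj₁ (proj₂ iso)

  enum : B.Car → A.Car
  enum b = proj₁ (proj₁ (point b))

  enum-mono : ∀ x y → x B.≺ y → enum x A.≺ enum y
  enum-mono x y x≺y with point x | point y
  ... | p , refl | q , refl = proj₂ (proj₂ (proj₂ iso) p q) x≺y

  enum-embeds : ∀ {c i} → Homog A c X i → Embeds A c B i
  enum-embeds homog = enum , λ x y x≺y → enum-mono x y x≺y ,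
    homog _ _ (proj₂ (proj₁ (point x))) (proj₂ (proj₁ (point y))) (enum-mono x y x≺y)

-- Cantor normal forms

module CNF (θ : Ordinal) where
  open Ordinal θ hiding (lo)
  open Order θ

  Term : Set
  Term = Car × ℕ

  infix 4 _<L_
  _<L_ : Rel (List Term) 0ℓ
  _<L_ = _<CNF_ θ

  <L-irrefl : ∀ x → ¬ x <L x
  <L-irrefl (_ ∷ r) (inj₁ a≺a)                    = irrefl refl a≺a
  <L-irrefl (_ ∷ r) (inj₂ (_ , inj₁ m<m))         = ℕ.<-irrefl refl m<m
  <L-irrefl (_ ∷ r) (inj₂ (_ , inj₂ (_ , r<r)))   = <L-irrefl r r<r

  <L-trans : ∀ x y z → x <L y → y <L z → x <L z
  <L-trans []      (_ ∷ _) (_ ∷ _) _ _ = tt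
  <L-trans (_ ∷ _) (_ ∷ _) (_ ∷ _) (inj₁ p)          (inj₁ q)          = inj₁ (≺-trans p q)
  <L-trans (_ ∷ _) (_ ∷ _) (_ ∷ _) (inj₁ p)          (inj₂ (refl , _)) = inj₁ p
  <L-trans (_ ∷ _) (_ ∷ _) (_ ∷ _) (inj₂ (refl , _)) (inj₁ q)          = inj₁ q
  <L-trans (_ ∷ _) (_ ∷ _) (_ ∷ _) (inj₂ (refl , inj₁ p)) (inj₂ (refl , inj₁ q)) =
    inj₂ (refl , inj₁ (ℕ.<-trans p q))
  <L-trans (_ ∷ _) (_ ∷ _) (_ ∷ _) (inj₂ (refl , inj₁ p)) (inj₂ (refl , inj₂ (refl , _))) =
    inj₂ (refl , inj₁ p)
  <L-trans (_ ∷ _) (_ ∷ _) (_ ∷ _) (inj₂ (refl , inj₂ (refl , _))) (inj₂ (refl , inj₁ q)) =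
    inj₂ (refl , inj₁ q)
  <L-trans (_ ∷ r) (_ ∷ s) (_ ∷ t) (inj₂ (refl , inj₂ (refl , p))) (inj₂ (refl , inj₂ (refl , q))) =
    inj₂ (refl , inj₂ (refl , <L-trans r s t p q))

  <L-total : ∀ x y → x <L y ⊎ x ≡ y ⊎ y <L x
  <L-total []      []      = inj₂ (inj₁ refl)
  <L-total []      (_ ∷ _) = inj₁ tt
  <L-total (_ ∷ _) []      = inj₂ (inj₂ tt)
  <L-total ((a , m) ∷ r) ((b , n) ∷ s) with compare a b
  ... | tri< p _ _ = inj₁ (inj₁ p)
  ... | tri> _ _ p = inj₂ (inj₂ (inj₁ p))
  ... | tri≈ _ refl _ with ℕ.<-cmp m n
  ...   | tri< p _ _ = inj₁ (inj₂ (refl , inj₁ p))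
  ...   | tri> _ _ p = inj₂ (inj₂ (inj₂ (refl , inj₁ p)))
  ...   | tri≈ _ refl _ with <L-total r s
  ...     | inj₁ p           = inj₁ (inj₂ (refl , inj₂ (refl , p)))
  ...     | inj₂ (inj₁ refl) = inj₂ (inj₁ refl)
  ...     | inj₂ (inj₂ p)    = inj₂ (inj₂ (inj₂ (refl , inj₂ (refl , p))))

  <L-isStrictTotalOrder : IsStrictTotalOrder _≡_ _<L_
  <L-isStrictTotalOrder =
    strictTotalOrder (λ { {x} refl → <L-irrefl x }) (λ {x} {y} {z} → <L-trans x y z) <L-total

  not-below-[] : ∀ x → ¬ x <L []
  not-below-[] [] ()
  not-below-[] (_ ∷ _) ()

  -- The form `(t , 0) ∷ []` is ω^t, coefficients being stored less one. Comparison with it bounds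
  -- all exponents of a descending form by `t`.
  head≺ : ∀ {t} x r → (x ∷ r) <L ((t , 0) ∷ []) → proj₁ x ≺ t
  head≺ x r (inj₁ p)                   = p
  head≺ x r (inj₂ (_ , inj₂ (_ , p))) = ⊥-elim (not-below-[] r p)

  Desc-tail : ∀ x r → Desc θ (x ∷ r) → Desc θ r
  Desc-tail x []      _ = tt
  Desc-tail x (_ ∷ _) D = proj₂ D

  Desc-tail< : ∀ x r → Desc θ (x ∷ r) → r <L ((proj₁ x , 0) ∷ [])
  Desc-tail< x []      _ = tt
  Desc-tail< x (_ ∷ _) D = inj₁ (proj₁ D)

  Desc-∷ : ∀ x r → r <L ((proj₁ x , 0) ∷ []) → Desc θ r → Desc θ (x ∷ r)
  Desc-∷ x []      _ _ = tt
  Desc-∷ x (y ∷ r) p D = head≺ y r p , D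

  desc? : ∀ x → Dec (Desc θ x)
  desc? []          = yes tt
  desc? (_ ∷ [])    = yes tt
  desc? (x ∷ y ∷ r) = (proj₁ y <? proj₁ x) ×-dec desc? (y ∷ r)

  private
    _<P_ : Rel (Σ (List Term) (Desc θ)) 0ℓ
    p <P q = proj₁ p <L proj₁ q

    mutual
      -- Induction on the leading exponent, then its coefficient, then the tail. A form below ω^t
      -- leads with some `s ≺ t`, and its tail lies below ω^s, so the tail is accessible before the
      -- form itself is treated.
      acc-below : ∀ {t} → Acc _≺_ t → ∀ r D → r <L ((t , 0) ∷ []) → Acc _<P_ (r , D)
      acc-below a        []      D _ = acc λ {y} p → ⊥-elim (not-below-[] (proj₁ y) p)
      acc-below (acc rs) (x ∷ r) D p =
        acc-∷ (rs (head≺ x r p)) (ℕ.<-wellFounded _) r (Desc-tail x r D)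
          (acc-below (rs (head≺ x r p)) r (Desc-tail x r D) (Desc-tail< x r D)) D

      acc-∷ : ∀ {s n} → Acc _≺_ s → Acc _<ℕ_ n → ∀ r Dr → Acc _<P_ (r , Dr) →
              ∀ D → Acc _<P_ ((s , n) ∷ r , D)
      acc-∷ a an r Dr ar D = acc λ {y} → acc-∷-step a an r Dr ar (proj₁ y) (proj₂ y)

      acc-∷-step : ∀ {s n} → Acc _≺_ s → Acc _<ℕ_ n → ∀ r Dr → Acc _<P_ (r , Dr) →
                   ∀ y D → y <L ((s , n) ∷ r) → Acc _<P_ (y , D)
      acc-∷-step a an r Dr ar [] D _ = acc-below a [] D tt
      acc-∷-step a an r Dr ar (x ∷ y) D (inj₁ x≺s) = acc-below a (x ∷ y) D (inj₁ x≺s)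
      acc-∷-step a (acc ns) r Dr ar (x ∷ y) D (inj₂ (refl , inj₁ m<n)) =
        acc-∷ a (ns m<n) y (Desc-tail x y D) (acc-below a y (Desc-tail x y D) (Desc-tail< x y D)) D
      acc-∷-step a an r Dr (acc rs) (x ∷ y) D (inj₂ (refl , inj₂ (refl , y<r))) =
        acc-∷ a an y (Desc-tail x y D) (rs y<r) D

    <P-wellFounded : WellFounded _<P_
    <P-wellFounded ([] , D) = acc λ {y} p → ⊥-elim (not-below-[] (proj₁ y) p)
    <P-wellFounded (x ∷ r , D) =
      acc-∷ (wf _) (ℕ.<-wellFounded _) r (Desc-tail x r D)
        (acc-below (wf _) r (Desc-tail x r D) (Desc-tail< x r D)) D

    -- Accessibility is shown for relevant proofs of `Desc`; decidability recovers one from the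
    -- irrelevant field.
    relevant : Sub (Desc θ) → Σ (List Term) (Desc θ)
    relevant (x ∣ D) = x , recompute (desc? x) D

  -- ωpow θ itself need not be an Ordinal: its elements carry proofs of Desc,
  -- which may differ for one and the same list.
  ω^ : Ordinal
  ω^ = record
    { lo    = record { Car = Sub (Desc θ) ; _≺_ = λ x y → val x <L val y }
    ; isSTO = sub-isStrictTotalOrder (Desc θ) <L-isStrictTotalOrder
    ; wf    = On.wellFounded relevant <P-wellFounded
    }

  -- Rank and limits in ω^θ.

  rank : List Term → Maybe Car
  -- The point 0 has no last exponent.
  rank []             = nothing
  rank ((a , _) ∷ []) = just a
  rank (_ ∷ y ∷ r)    = rank (y ∷ r)

  rank-just : ∀ x r → ∃ λ t → rank (x ∷ r) ≡ just t
  rank-just (a , _) []  = a , refl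
  rank-just x (y ∷ r)   = rank-just y r

  rank-below : ∀ {t} x r → Desc θ (x ∷ r) → (x ∷ r) <L ((t , 0) ∷ []) →
               ∃ λ s → rank (x ∷ r) ≡ just s × s ≺ t
  rank-below x []      D p = proj₁ x , refl , head≺ x [] p
  rank-below x (y ∷ r) D p = rank-below y r (proj₂ D) (inj₁ (≺-trans (proj₁ D) (head≺ x (y ∷ r) p)))

  -- Here y = l + ω^t: the last coefficient is lowered by one, or the last term removed if its
  -- coefficient is one. A point strictly between `l` and `y` is `l` plus a nonzero remainder below
  -- ω^t, and has the rank of that remainder.
  rank-drops : ∀ y {t} → Desc θ y → rank y ≡ just t →
    Σ (List Term) λ l → Desc θ l × l <L y ×
      (∀ z → Desc θ z → l <L z → z <L y → ∃ λ s → rank z ≡ just s × s ≺ t)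
  rank-drops ((t , zero) ∷ []) D refl = [] , tt , tt , λ
    { (x ∷ z) Dz _ z<y → rank-below x z Dz z<y }
  rank-drops ((t , suc k) ∷ []) D refl = (t , k) ∷ [] , tt , inj₂ (refl , inj₁ ℕ.≤-refl) , between
    where
    between : ∀ z → Desc θ z → ((t , k) ∷ []) <L z → z <L ((t , suc k) ∷ []) →
              ∃ λ s → rank z ≡ just s × s ≺ t
    between (_ ∷ z) Dz (inj₁ t≺a) (inj₁ a≺t) = ⊥-elim (irrefl refl (≺-trans t≺a a≺t))
    between (_ ∷ z) Dz (inj₁ t≺a) (inj₂ (refl , _)) = ⊥-elim (irrefl refl t≺a)
    between (_ ∷ z) Dz (inj₂ (refl , _)) (inj₁ a≺t) = ⊥-elim (irrefl refl a≺t)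
    between (_ ∷ z) Dz (inj₂ (refl , _)) (inj₂ (_ , inj₂ (_ , z<[]))) = ⊥-elim (not-below-[] z z<[])
    between (_ ∷ z) Dz (inj₂ (refl , inj₁ k<m)) (inj₂ (_ , inj₁ (s≤s m≤k))) =
      ⊥-elim (ℕ.<-irrefl refl (ℕ.<-≤-trans k<m m≤k))
    -- The one consistent case: `w` is the term of `l`, and `x ∷ z` is the remainder.
    between (w ∷ x ∷ z) Dz (inj₂ (refl , inj₂ (refl , _))) (inj₂ (_ , inj₁ _)) =
      rank-below x z (proj₂ Dz) (Desc-tail< w (x ∷ z) Dz)
  rank-drops (x ∷ y ∷ r) {t} D eq with rank-drops (y ∷ r) (proj₂ D) eq
  ... | l , Dl , l<y , drops = x ∷ l , Desc-∷ x l l<x Dl , inj₂ (refl , inj₂ (refl , l<y)) , between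
    where
    l<x : l <L ((proj₁ x , 0) ∷ [])
    l<x = <L-trans l (y ∷ r) _ l<y (Desc-tail< x (y ∷ r) D)

    between : ∀ z → Desc θ z → (x ∷ l) <L z → z <L (x ∷ y ∷ r) → ∃ λ s → rank z ≡ just s × s ≺ t
    between (_ ∷ z) Dz (inj₁ x≺a) (inj₁ a≺x) = ⊥-elim (irrefl refl (≺-trans x≺a a≺x))
    between (_ ∷ z) Dz (inj₁ x≺a) (inj₂ (refl , _)) = ⊥-elim (irrefl refl x≺a)
    between (_ ∷ z) Dz (inj₂ (refl , _)) (inj₁ a≺x) = ⊥-elim (irrefl refl a≺x)
    between (_ ∷ z) Dz (inj₂ (refl , inj₁ k<m)) (inj₂ (_ , inj₁ m<k)) =
      ⊥-elim (ℕ.<-irrefl refl (ℕ.<-trans k<m m<k))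
    between (_ ∷ z) Dz (inj₂ (refl , inj₁ k<m)) (inj₂ (_ , inj₂ (refl , _))) =
      ⊥-elim (ℕ.<-irrefl refl k<m)
    between (_ ∷ z) Dz (inj₂ (refl , inj₂ (refl , _))) (inj₂ (_ , inj₁ m<k)) =
      ⊥-elim (ℕ.<-irrefl refl m<k)
    between (_ ∷ [])    Dz (inj₂ (refl , inj₂ (refl , l<z))) _ = ⊥-elim (not-below-[] l l<z)
    between (_ ∷ w ∷ z) Dz (inj₂ (refl , inj₂ (refl , l<z))) (inj₂ (_ , inj₂ (_ , z<y))) =
      drops (w ∷ z) (proj₂ Dz) l<z z<y

  private
    Approximation : (l b : List Term) → Car → Set
    Approximation l b s =
      Σ (List Term) λ b′ → Desc θ b′ × l <L b′ × b′ <L b × rank b′ ≡ just s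

    -- If `l` leads with an exponent below `t`, one term of exponent `s` is placed just high enough
    -- to pass `l`. If it leads with `t`, that term is kept and its tail is approximated below ω^t.
    approximate-single : ∀ l t k {s} → Desc θ l → l <L ((t , k) ∷ []) → s ≺ t →
                         Approximation l ((t , k) ∷ []) s
    approximate-single [] t k {s} _ _ s≺t = (s , 0) ∷ [] , tt , tt , inj₁ s≺t , refl
    approximate-single ((a , j) ∷ l) t k {s} _ (inj₁ a≺t) s≺t with compare a s
    ... | tri< a≺s _ _  = (s , 0) ∷ [] , tt , inj₁ a≺s , inj₁ s≺t , refl
    -- Raising the leading coefficient of `l` by one passes `l` whatever its tail is.
    ... | tri≈ _ refl _ = (s , suc j) ∷ [] , tt , inj₂ (refl , inj₁ ℕ.≤-refl) , inj₁ s≺t , refl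
    ... | tri> _ _ s≺a  = (a , suc j) ∷ (s , 0) ∷ [] , (s≺a , tt) ,
                          inj₂ (refl , inj₁ ℕ.≤-refl) , inj₁ a≺t , refl
    approximate-single (w ∷ l) t k D (inj₂ (refl , inj₁ j<k)) s≺t
      with approximate-single l t 0 (Desc-tail w l D) (Desc-tail< w l D) s≺t
    ... | x ∷ b , Db , l<b , b<t , eq =
      w ∷ x ∷ b , Desc-∷ w (x ∷ b) b<t Db , inj₂ (refl , inj₂ (refl , l<b)) ,
      inj₂ (refl , inj₁ j<k) , eq
    approximate-single (_ ∷ l) t k _ (inj₂ (_ , inj₂ (_ , l<[]))) _ = ⊥-elim (not-below-[] l l<[])

    -- When `l` already falls short of `x` at its head, every form starting with `x` exceeds it and
    -- `[]` suffices; otherwise the tail of `l` is the new bound.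
    tail-bound : ∀ x y b l → Desc θ l → l <L (x ∷ y ∷ b) →
      Σ (List Term) λ l′ → Desc θ l′ × l′ <L (y ∷ b) × (∀ z → l′ <L z → l <L (x ∷ z))
    tail-bound x y b []      _ _        = [] , tt , tt , λ _ _ → tt
    tail-bound x y b (_ ∷ l) _ (inj₁ p) = [] , tt , tt , λ _ _ → inj₁ p
    tail-bound x y b (_ ∷ l) _ (inj₂ (refl , inj₁ p)) = [] , tt , tt , λ _ _ → inj₂ (refl , inj₁ p)
    tail-bound x y b (w ∷ l) D (inj₂ (refl , inj₂ (refl , p))) =
      l , Desc-tail w l D , p , λ _ q → inj₂ (refl , inj₂ (refl , q))

    -- All terms but the last are kept, and the search takes place below the last one.
    approximate-∷ : ∀ x b l {s t} → Desc θ (x ∷ b) → Desc θ l → l <L (x ∷ b) →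
                    rank (x ∷ b) ≡ just t → s ≺ t → Approximation l (x ∷ b) s
    approximate-∷ (t , k) [] l D Dl l<b refl s≺t = approximate-single l t k Dl l<b s≺t
    approximate-∷ x (y ∷ b) l D Dl l<b eq s≺t with tail-bound x y b l Dl l<b
    ... | l′ , Dl′ , l′<b , bound with approximate-∷ y b l′ (proj₂ D) Dl′ l′<b eq s≺t
    ...   | w ∷ b′ , D′ , l′<b′ , b′<b , eq′ =
      x ∷ w ∷ b′ ,
      Desc-∷ x (w ∷ b′) (<L-trans (w ∷ b′) (y ∷ b) _ b′<b (Desc-tail< x (y ∷ b) D)) D′ ,
      bound (w ∷ b′) l′<b′ , inj₂ (refl , inj₂ (refl , b′<b)) , eq′

  approximate : ∀ b (l : Maybe (Σ (List Term) (Desc θ))) {s t} (D : Desc θ b) →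
    Above (ωpow θ) l (b , D) → rank b ≡ just t → s ≺ t →
    Σ (List Term) λ b′ → Σ (Desc θ b′) λ D′ →
      Above (ωpow θ) l (b′ , D′) × b′ <L b × rank b′ ≡ just s
  approximate (x ∷ b) (just (l , Dl)) D l<b eq s≺t = approximate-∷ x b l D Dl l<b eq s≺t
  -- A missing lower bound is replaced by 0, which lies below any form that has a rank.
  approximate (x ∷ b) nothing         D _   eq s≺t =
    let b′ , D′ , _ , b′<b , eq′ = approximate-∷ x b [] D tt tt eq s≺t in b′ , D′ , tt , b′<b , eq′

  Below-mono : ∀ (u : Maybe (Σ (List Term) (Desc θ))) {x y} →
               proj₁ x <L proj₁ y → Below (ωpow θ) u y → Below (ωpow θ) u x
  Below-mono nothing        x<y _   = tt
  Below-mono (just u) {x} {y} x<y y<u = <L-trans (proj₁ x) (proj₁ y) (proj₁ u) x<y y<u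

-- The ranks in ω^θ of the points of a closed copy of ω^α

module ClosedCopyRanks (α θ : Ordinal) (X : LO.Car (ωpow θ) → Set)
                       (copy : ClosedCopy (ωpow θ) X (ωpow α)) where
  private
    module α where
      open Ordinal α public
      open CNF α public
    module θ where
      open Ordinal θ public
      open CNF θ public

    h : Σ (LO.Car (ωpow θ)) X → LO.Car (ωpow α)
    h = proj₁ copy

    iso : IsOrderIso (ωpow θ) X (ωpow α) h
    iso = proj₁ (proj₂ copy)

  open Enumeration (ωpow θ) X (ωpow α) h iso

  -- For fixed `β` this is the set of ranks whose least element becomes the image of `β`.
  RankAt : α.Car → θ.Car → Set
  RankAt β t = Σ (Σ (LO.Car (ωpow θ)) X) λ p →
    α.rank (proj₁ (h p)) ≡ just β × θ.rank (proj₁ (proj₁ p)) ≡ just t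

  rankAt-inhabited : ∀ β → ∃ (RankAt β)
  rankAt-inhabited β with point ((β , 0) ∷ [] , tt) in eq
  ... | ((x ∷ r , D) , px) , h≡ =
    let t , rank≡ = θ.rank-just x r
    in t , ((x ∷ r , D) , px) , cong (λ b → α.rank (proj₁ b)) h≡ , rank≡
  -- The point that `h` sends to ω^β lies above the one sent to 0, so it is not the empty form.
  ... | (([] , D) , px) , h≡ = ⊥-elim (θ.not-below-[] _
    (subst (λ q → proj₁ (enum ([] , tt)) θ.<L proj₁ (proj₁ (proj₁ q))) eq
      (enum-mono ([] , tt) ((β , 0) ∷ [] , tt) tt)))

  -- Choose `l` so that ranks strictly between `l` and `p` are below `t`. The points of `X` above
  -- `l` are open in `X`, so `h` sends them onto a neighbourhood of `h p`. This contains a point of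
  -- rank `β` below `h p`, whose preimage lies between `l` and `p`.
  rankAt-descends : ∀ {β γ t} → β α.≺ γ → RankAt γ t → ∃ λ s → RankAt β s × s θ.≺ t
  rankAt-descends {β} {γ} β≺γ (p , rank-hp , rank-p)
    with θ.rank-drops (proj₁ (proj₁ p)) (proj₂ (proj₁ p)) rank-p
  ... | l , Dl , l<p , drops
    with proj₂ (proj₂ (proj₂ copy)) (λ q → l θ.<L proj₁ (proj₁ q))
           ((λ z → l θ.<L proj₁ z)
           , (λ x l<x → just (l , Dl) , nothing , l<x , tt , λ _ l<y _ → l<y)
           , λ _ → (λ l<q → l<q) , (λ l<q → l<q))
           (h p) (p , refl , l<p)
  ... | lower , upper , above , below , inside
    with α.approximate (proj₁ (h p)) lower (proj₂ (h p)) above rank-hp β≺γ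
  ... | b , D , above′ , b<hp , rank-b
    -- Since `b` lies below `h p`, it respects the upper end of the interval.
    with inside (b , D) above′ (α.Below-mono upper b<hp below)
  ... | q , hq≡b , l<q
    with drops (proj₁ (proj₁ q)) (proj₂ (proj₁ q)) l<q
           (proj₂ (proj₂ (proj₂ iso) q p) (subst (λ z → proj₁ z α.<L proj₁ (h p)) (sym hq≡b) b<hp))
  ... | s , rank-q , s≺t =
    s , (q , trans (cong (λ z → α.rank (proj₁ z)) hq≡b) rank-b , rank-q) , s≺t

-- The colouring of ω^θ by ranks.

module RankColouring (θ : Ordinal) (d : Colouring (lo θ)) where
  open Ordinal θ hiding (lo)
  open Order θ
  open CNF θ

  -- An increasing pair of points can have its ranks in either order, so `d` is extended to all
  -- pairs of ranks.
  symmetrize : Car → Car → Fin 2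
  symmetrize t u with compare t u
  ... | tri< _ _ _ = d t u
  ... | tri≈ _ _ _ = zero
  ... | tri> _ _ _ = d u t

  symmetrize-≺ : ∀ {t u} → t ≺ u → symmetrize t u ≡ d t u
  symmetrize-≺ {t} {u} t≺u with compare t u
  ... | tri< _ _ _    = refl
  ... | tri≈ ¬t≺u _ _ = ⊥-elim (¬t≺u t≺u)
  ... | tri> ¬t≺u _ _ = ⊥-elim (¬t≺u t≺u)

  symmetrize-≻ : ∀ {t u} → u ≺ t → symmetrize t u ≡ d u t
  symmetrize-≻ {t} {u} u≺t with compare t u
  ... | tri< _ _ ¬u≺t = ⊥-elim (¬u≺t u≺t)
  ... | tri≈ _ _ ¬u≺t = ⊥-elim (¬u≺t u≺t)
  ... | tri> _ _ _    = refl

  _⟶_ : Rel Car 0ℓ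
  t ⟶ u = t ≺ u × d t u ≡ suc zero

  symmetrize-1 : ∀ t u → symmetrize t u ≡ suc zero → t ⟶ u ⊎ u ⟶ t
  symmetrize-1 t u eq with compare t u
  ... | tri< t≺u _ _ = inj₁ (t≺u , eq)
  ... | tri> _ _ u≺t = inj₂ (u≺t , eq)

  colour : Maybe Car → Maybe Car → Fin 2
  colour (just t) (just u) = symmetrize t u
  colour _        _        = zero

  rankColouring : Colouring (ωpow θ)
  rankColouring x y = colour (rank (proj₁ x)) (rank (proj₁ y))

  triangle : ∀ {t u v} → t ⟶ u → u ⟶ v → t ⟶ v → Embeds (lo θ) d (lo (fin 3)) (suc zero)
  triangle {t} {u} {v} tu uv tv = vertex , edge
    where
    vertex : Fin 3 → Car
    vertex zero             = t
    vertex (suc zero)       = u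
    vertex (suc (suc zero)) = v

    edge : ∀ x y → LO._≺_ (lo (fin 3)) x y → vertex x ⟶ vertex y
    edge zero       (suc zero)       _ = tu
    edge zero       (suc (suc zero)) _ = tv
    edge (suc zero) (suc (suc zero)) _ = uv
    edge (suc zero)       (suc zero)       (s≤s ())
    edge (suc (suc zero)) (suc zero)       (s≤s ())
    edge (suc (suc zero)) (suc (suc zero)) (s≤s (s≤s ()))

  -- Of the eight orientations of a triangle, six are linear orders, which give the increasing
  -- triple; the two cyclic ones contradict irreflexivity.
  sorted-triangle : ∀ {t u v} → t ⟶ u ⊎ u ⟶ t → u ⟶ v ⊎ v ⟶ u → t ⟶ v ⊎ v ⟶ t →
                    Embeds (lo θ) d (lo (fin 3)) (suc zero)
  sorted-triangle (inj₁ tu) (inj₁ uv) (inj₁ tv) = triangle tu uv tv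
  sorted-triangle (inj₁ tu) (inj₂ vu) (inj₁ tv) = triangle tv vu tu
  sorted-triangle (inj₁ tu) (inj₂ vu) (inj₂ vt) = triangle vt tu vu
  sorted-triangle (inj₂ ut) (inj₁ uv) (inj₁ tv) = triangle ut tv uv
  sorted-triangle (inj₂ ut) (inj₁ uv) (inj₂ vt) = triangle uv vt ut
  sorted-triangle (inj₂ ut) (inj₂ vu) (inj₂ vt) = triangle vu ut vt
  sorted-triangle (inj₁ tu) (inj₁ uv) (inj₂ vt) =
    ⊥-elim (irrefl refl (≺-trans (≺-trans (proj₁ tu) (proj₁ uv)) (proj₁ vt)))
  sorted-triangle (inj₂ ut) (inj₂ vu) (inj₁ tv) =
    ⊥-elim (irrefl refl (≺-trans (≺-trans (proj₁ tv) (proj₁ vu)) (proj₁ ut)))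

  colour-triangle : ∀ t u v → colour t u ≡ suc zero → colour u v ≡ suc zero → colour t v ≡ suc zero →
                    Embeds (lo θ) d (lo (fin 3)) (suc zero)
  colour-triangle (just t) (just u) (just v) tu uv tv =
    sorted-triangle (symmetrize-1 t u tu) (symmetrize-1 u v uv) (symmetrize-1 t v tv)

  rankColouring-triangle : Embeds (ωpow θ) rankColouring (lo (fin 3)) (suc zero) →
                           Embeds (lo θ) d (lo (fin 3)) (suc zero)
  rankColouring-triangle (f , emb) =
    colour-triangle (rank (proj₁ (f zero))) (rank (proj₁ (f (suc zero)))) (rank (proj₁ (f (suc (suc zero)))))
      (proj₂ (emb zero (suc zero) (s≤s z≤n)))
      (proj₂ (emb (suc zero) (suc (suc zero)) (s≤s (s≤s z≤n))))
      (proj₂ (emb zero (suc (suc zero)) (s≤s z≤n)))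

  homogeneous-ranks : ∀ {X} → Homog (ωpow θ) rankColouring X zero →
    ∀ {s t} (p q : Σ (LO.Car (ωpow θ)) X) →
    rank (proj₁ (proj₁ p)) ≡ just s → rank (proj₁ (proj₁ q)) ≡ just t → s ≺ t → d s t ≡ zero
  homogeneous-ranks homog {s} {t} ((x , Dx) , px) ((y , Dy) , py) rank-x rank-y s≺t with <L-total x y
  ... | inj₁ x<y = trans (sym (symmetrize-≺ s≺t)) (trans (sym (cong₂ colour rank-x rank-y)) (homog _ _ px py x<y))
  ... | inj₂ (inj₁ refl) = ⊥-elim (irrefl (just-injective (trans (sym rank-x) rank-y)) s≺t)
  ... | inj₂ (inj₂ y<x) = trans (sym (symmetrize-≻ s≺t)) (trans (sym (cong₂ colour rank-y rank-x)) (homog _ _ py px y<x))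

-- From the closed relation to the classical ones.

LeastElements : Ordinal → Set₁
LeastElements θ = ∀ Q → Sub Q → ∃ (IsLeast (sub θ Q))

arrow-from-closed : ∀ α θ → LeastElements θ →
  ArrowCl (ωpow θ) (ωpow α) (lo (fin 3)) → Arrow (lo θ) (lo α) (lo (fin 3))
arrow-from-closed α θ least →cl = arrow θ α (fin 3) embed
  where
  open Ordinal θ hiding (lo)
  open Order θ

  embed : ∀ d → Embeds (lo θ) d (lo α) zero ⊎ Embeds (lo θ) d (lo (fin 3)) (suc zero)
  embed d with →cl (RankColouring.rankColouring θ d)
  ... | X , inj₂ ((h , iso , _) , homog) =
    inj₂ (RankColouring.rankColouring-triangle θ d
      (Enumeration.enum-embeds (ωpow θ) X (lo (fin 3)) h iso homog))
  ... | X , inj₁ (copy , homog) =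
    inj₁ ((λ β → val (min β)) , λ β γ β≺γ →
      let f≺ = increasing β≺γ (min β) (min-least β) (min γ) in f≺ , red (min β) (min γ) f≺)
    where
    open ClosedCopyRanks α θ X copy

    min : ∀ β → Sub (RankAt β)
    min β = let t , r = rankAt-inhabited β in proj₁ (least (RankAt β) (t ∣ r))

    min-least : ∀ β → IsLeast (sub θ (RankAt β)) (min β)
    min-least β = let t , r = rankAt-inhabited β in proj₂ (least (RankAt β) (t ∣ r))

    -- Each rank at `γ` exceeds some rank at `β`, which is at least the minimum there.
    increasing : ∀ {β γ} → Ordinal._≺_ α β γ → (m : Sub (RankAt β)) →
                 IsLeast (sub θ (RankAt β)) m → (n : Sub (RankAt γ)) → val m ≺ val n
    -- Membership of `t` is irrelevant, but it may be used because the order of `θ` is decidable.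
    increasing {β} β≺γ (s ∣ _) s-least (t ∣ rt) = recompute (s <? t) (below (rankAt-descends β≺γ rt))
      where
      below : (∃ λ u → RankAt β u × u ≺ t) → s ≺ t
      below (u , ru , u≺t) with total s u
      ... | inj₁ s≺u         = ≺-trans s≺u u≺t
      ... | inj₂ (inj₁ refl) = u≺t
      ... | inj₂ (inj₂ u≺s)  = ⊥-elim (s-least (u ∣ ru) u≺s)

    red : ∀ {β γ} (m : Sub (RankAt β)) (n : Sub (RankAt γ)) → val m ≺ val n → d (val m) (val n) ≡ zero
    red (s ∣ rs) (t ∣ rt) s≺t = recompute (d s t ≟ zero) (colour-0 rs rt)
      where
      colour-0 : ∀ {β γ} → RankAt β s → RankAt γ t → d s t ≡ zero
      colour-0 (p , _ , rank-p) (q , _ , rank-q) =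
        RankColouring.homogeneous-ranks θ d homog p q rank-p rank-q s≺t

-- The colouring is restricted to the right summand. A copy of ω^α contains a copy of α, formed by
-- the points corresponding to the powers ω^a.
arrow-⊕ω^ : ∀ α θ W → ArrowCl (ωpow θ) (ωpow α) (lo (fin 3)) →
            Arrow (lo (W ⊕ CNF.ω^ θ)) (lo α) (lo (fin 3))
arrow-⊕ω^ α θ W →cl = arrow (W ⊕ CNF.ω^ θ) α (fin 3) embed
  where
  right : LO.Car (ωpow θ) → Ordinal.Car (W ⊕ CNF.ω^ θ)
  right (x , D) = inj₂ (x ∣ D)

  embed : ∀ d → Embeds (lo (W ⊕ CNF.ω^ θ)) d (lo α) zero ⊎
                Embeds (lo (W ⊕ CNF.ω^ θ)) d (lo (fin 3)) (suc zero)
  embed d with →cl (λ x y → d (right x) (right y))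
  ... | X , inj₁ ((h , iso , _) , homog) =
    let f , emb = Enumeration.enum-embeds (ωpow θ) X (ωpow α) h iso homog
    in inj₁ ((λ a → right (f ((a , 0) ∷ [] , tt))) , λ a b a≺b → emb _ _ (inj₁ a≺b))
  ... | X , inj₂ ((h , iso , _) , homog) =
    let f , emb = Enumeration.enum-embeds (ωpow θ) X (lo (fin 3)) h iso homog
    in inj₂ ((λ i → right (f i)) , emb)

least-elements : ∀ θ Γ {t₀} → IsLeast θ t₀ → (∀ W → OrdLt θ (W ⊕ Γ)) → LeastElements θ
least-elements θ Γ {t₀} t₀-least θ<W⊕Γ Q w =
  first (proj₁ θ≤ t₀) (OrdLe-least θ (sub θ Q ⊕ Γ) θ≤ t₀-least)
  where
  θ≤ : OrdLe θ (sub θ Q ⊕ Γ)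
  θ≤ = OrdLt⇒OrdLe θ (sub θ Q ⊕ Γ) (θ<W⊕Γ (sub θ Q))

  first : ∀ x → IsLeast (sub θ Q ⊕ Γ) x → ∃ (IsLeast (sub θ Q))
  first (inj₁ m) x-least = m , λ v → x-least (inj₁ v)
  first (inj₂ _) x-least = ⊥-elim (x-least (inj₁ w) tt)

theorem1p2 : (α θ : Ordinal) → Countable θ
    → OrdLe (fin 1) α → OrdLe α θ
    → (∀ (γ : Ordinal) → Arrow (Ordinal.lo γ) (Ordinal.lo α) (Ordinal.lo (fin 3)) → OrdLt θ γ)
    → ¬ ArrowCl (ωpow θ) (ωpow α) (Ordinal.lo (fin 3))
theorem1p2 α θ _ 1≤α α≤θ θ<R →cl =
  OrdLt-irrefl θ (θ<R θ (arrow-from-closed α θ least →cl))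
  where
  zero-least : IsLeast (fin 1) zero
  zero-least zero ()

  least : LeastElements θ
  -- The least element of `θ` is the image of 0 along 1 ≤ α ≤ θ.
  least = least-elements θ (CNF.ω^ θ) (OrdLe-least α θ α≤θ (OrdLe-least (fin 1) α 1≤α zero-least))
    λ W → θ<R (W ⊕ CNF.ω^ θ) (arrow-⊕ω^ α θ W →cl)
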